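{- Let $\mathbf{L}$ be a ring, or $\mathbf{L}=\mathbb{N}$, or $\mathbf{L}=\mathbb{N}\setminus\{0\}$, and let $x,y,z\in\mathbf{L}$. Then $x+y=z$ if and only if \[ (zx+1)(zy+1)=z^2(xy+1)+1 \quad\text{and}\quad ((z+1)x+1)((z+1)(y+1)+1)=(z+1)^2(x(y+1)+1)+1 . \] Moreover, the conjunction of these two equations can be expressed as a system $\mathcal{F}$ which involves $x,y,z$ and $20$ new variables and consists only of equations of the forms $\alpha+1=\gamma$ and $\alpha\cdot\beta=\gamma$ (with $\alpha,\beta,\gamma$ variables), in the sense that $x,y,z\in\mathbf{L}$ satisfy both equations if and only if the new variables can be assigned values in $\mathbf{L}$ so that $\mathcal{F}$ holds.
   Context: Here "ring" means commutative ring with identity $1$. -}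

module Defs where

open import Level using (Level; _⊔_; 0ℓ; Setω)
open import Data.Nat as ℕ using (ℕ; suc; NonZero)
open import Data.Product using (Σ; _×_; _,_; proj₁; ∃)
open import Data.Fin using (Fin)
open import Data.List using (List)
open import Data.List.Relation.Unary.All using (All)
open import Data.Sum using (_⊎_; inj₁; inj₂)
open import Function.Bundles using (_⇔_)
open import Relation.Binary.PropositionalEquality using (_≡_)
open import Algebra.Bundles using (CommutativeRing)

record Arith (a ℓ : Level) : Set (Level.suc (a ⊔ ℓ)) where
  field
    Carrier : Set a
    _≈_     : Carrier → Carrier → Set ℓ
    _+_     : Carrier → Carrier → Carrier
    _*_     : Carrier → Carrier → Carrier
    1#      : Carrier

ringArith : ∀ {c ℓ} → CommutativeRing c ℓ → Arith c ℓ
ringArith R = record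
  { Carrier = CommutativeRing.Carrier R
  ; _≈_ = CommutativeRing._≈_ R
  ; _+_ = CommutativeRing._+_ R
  ; _*_ = CommutativeRing._*_ R
  ; 1# = CommutativeRing.1# R
  }

ℕArith : Arith 0ℓ 0ℓ
ℕArith = record { Carrier = ℕ ; _≈_ = _≡_ ; _+_ = ℕ._+_ ; _*_ = ℕ._*_ ; 1# = 1 }

ℕ⁺ : Set
ℕ⁺ = Σ ℕ NonZero

private
  nz+ : ∀ m n → NonZero m → NonZero (m ℕ.+ n)
  nz+ (suc m) n _ = record { nonZero = _ }

  nz* : ∀ m n → NonZero m → NonZero n → NonZero (m ℕ.* n)
  nz* (suc m) (suc n) _ _ = record { nonZero = _ }

ℕ⁺Arith : Arith 0ℓ 0ℓ
ℕ⁺Arith = record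
  { Carrier = ℕ⁺
  ; _≈_ = λ a b → proj₁ a ≡ proj₁ b
  ; _+_ = λ { (m , p) (n , q) → (m ℕ.+ n , nz+ m n p) }
  ; _*_ = λ { (m , p) (n , q) → (m ℕ.* n , nz* m n p q) }
  ; 1# = (1 , record { nonZero = _ })
  }

-- Atomic equations of a system: variables are indices in Fin (3 + 20);
-- index 0,1,2 are x,y,z, indices 3..22 are the 20 new variables.
data AtomEq (n : ℕ) : Set where
  plus1 : (α γ : Fin n) → AtomEq n
  times : (α β γ : Fin n) → AtomEq n

module _ {a ℓ} (L : Arith a ℓ) where
  open Arith L

  valuation : Carrier → Carrier → Carrier → (Fin 20 → Carrier) → Fin 23 → Carrier
  valuation x y z w Fin.zero = x
  valuation x y z w (Fin.suc Fin.zero) = y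
  valuation x y z w (Fin.suc (Fin.suc Fin.zero)) = z
  valuation x y z w (Fin.suc (Fin.suc (Fin.suc i))) = w i

  HoldsAtom : (Fin 23 → Carrier) → AtomEq 23 → Set ℓ
  HoldsAtom v (plus1 α γ) = (v α + 1#) ≈ v γ
  HoldsAtom v (times α β γ) = (v α * v β) ≈ v γ

  Eq1 : Carrier → Carrier → Carrier → Set ℓ
  Eq1 x y z = (((z * x) + 1#) * ((z * y) + 1#)) ≈ (((z * z) * ((x * y) + 1#)) + 1#)

  Eq2 : Carrier → Carrier → Carrier → Set ℓ
  Eq2 x y z = ((((z + 1#) * x) + 1#) * (((z + 1#) * (y + 1#)) + 1#))
              ≈ ((((z + 1#) * (z + 1#)) * ((x * (y + 1#)) + 1#)) + 1#)

  Lemma3For : Set (a ⊔ ℓ)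
  Lemma3For =
    (∀ x y z → ((x + y) ≈ z) ⇔ (Eq1 x y z × Eq2 x y z))
    × Σ (List (AtomEq 23)) (λ F →
        ∀ x y z → (Eq1 x y z × Eq2 x y z)
                  ⇔ Σ (Fin 20 → Carrier) (λ w → All (HoldsAtom (valuation x y z w)) F))

record Lemma3Statement : Setω where
  field
    forRings : ∀ {c ℓ} (R : CommutativeRing c ℓ) → Lemma3For (ringArith R)
    forℕ     : Lemma3For ℕArith
    forℕ⁺    : Lemma3For ℕ⁺Arith

{-# OPTIONS --safe #-}
module Submission where

open import Defs
open import Level using (_⊔_)
import Data.Nat as ℕ
open import Data.Nat.Properties using (+-*-commutativeSemiring; +-cancelˡ-≡)
open import Data.Product using (Σ; _×_; _,_; proj₁)
open import Data.Fin using (Fin; #_)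
open import Data.Vec using (Vec; []; _∷_; lookup; _++_)
open import Data.List as List using (List; []; _∷_)
open import Data.List.Relation.Unary.All using (All; []; _∷_)
open import Data.List.Relation.Unary.All.Properties using (++⁺; ++⁻)
open import Function.Bundles using (_⇔_; mk⇔; module Equivalence)
open import Relation.Binary.Bundles using (Setoid)
open import Relation.Binary.Structures using (IsEquivalence)
import Relation.Binary.PropositionalEquality as ≡
import Relation.Binary.Construct.On as On
import Relation.Binary.Reasoning.Setoid as SetoidReasoning
open import Algebra.Bundles using (CommutativeRing; CommutativeSemiring)
open import Algebra.Definitions using (LeftCancellative; Congruent₂)
import Algebra.Solver.Ring.NaturalCoefficients.Default as NaturalSolver
import Algebra.Properties.Group as GroupProperties

-- Expanding the products, Eq1 says z²xy + 1 + z(x + y) = z²xy + 1 + z², i.e. z(x + y) = z·z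
-- when addition cancels; and Eq2 x y z is literally Eq1 x (y + 1) (z + 1), which likewise
-- reduces to (z + 1)(x + y) = (z + 1)z. Subtracting the first of these from the second
-- leaves x + y = z, with no division by z needed. For the system, each copy of Eq1 is
-- flattened with nine auxiliary variables, and y + 1, z + 1 take the remaining two.

semiringArith : ∀ {c ℓ} → CommutativeSemiring c ℓ → Arith c ℓ
semiringArith S = record
  { Carrier = Carrier ; _≈_ = _≈_ ; _+_ = _+_ ; _*_ = _*_ ; 1# = 1# }
  where open CommutativeSemiring S

module AdditivelyCancellative {c ℓ} (S : CommutativeSemiring c ℓ)
  (+-cancelˡ : LeftCancellative (CommutativeSemiring._≈_ S) (CommutativeSemiring._+_ S))
  where

  open CommutativeSemiring S
  open SetoidReasoning setoid
  open NaturalSolver S using (solve; _:+_; _:*_; con; _:=_)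

  L : Arith c ℓ
  L = semiringArith S

  +-cancelʳ : ∀ a b d → (a + d) ≈ (b + d) → a ≈ b
  +-cancelʳ a b d a+d≈b+d = +-cancelˡ d a b (trans (+-comm d a) (trans a+d≈b+d (+-comm b d)))

  *-cancel-consecutive : ∀ z s t → (z * s) ≈ (z * t) → ((z + 1#) * s) ≈ ((z + 1#) * t) → s ≈ t
  *-cancel-consecutive z s t zs≈zt z+1s≈z+1t = +-cancelˡ (z * s) s t (begin
    z * s + s           ≈⟨ +-congˡ (*-identityˡ s) ⟨
    z * s + 1# * s      ≈⟨ distribʳ s z 1# ⟨
    (z + 1#) * s        ≈⟨ z+1s≈z+1t ⟩
    (z + 1#) * t        ≈⟨ distribʳ t z 1# ⟩
    z * t + 1# * t      ≈⟨ +-cong (sym zs≈zt) (*-identityˡ t) ⟩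
    z * s + t           ∎)

  *-suc-cancel : ∀ c s t → (c * (s + 1#)) ≈ (c * (t + 1#)) → (c * s) ≈ (c * t)
  *-suc-cancel c s t cs+1≈ct+1 = +-cancelʳ (c * s) (c * t) c (begin
    c * s + c           ≈⟨ +-congˡ (*-identityʳ c) ⟨
    c * s + c * 1#      ≈⟨ distribˡ c s 1# ⟨
    c * (s + 1#)        ≈⟨ cs+1≈ct+1 ⟩
    c * (t + 1#)        ≈⟨ distribˡ c t 1# ⟩
    c * t + c * 1#      ≈⟨ +-congˡ (*-identityʳ c) ⟩
    c * t + c           ∎)

  Eq1-expanded : ∀ x y z → (((z * x) + 1#) * ((z * y) + 1#)) ≈ ((z * z) * (x * y) + 1#) + z * (x + y)
  Eq1-expanded = solve 3 (λ x y z →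
    ((z :* x) :+ con 1) :* ((z :* y) :+ con 1) := ((z :* z) :* (x :* y) :+ con 1) :+ z :* (x :+ y)) refl

  square-expanded : ∀ x y z → ((z * z) * ((x * y) + 1#)) + 1# ≈ ((z * z) * (x * y) + 1#) + z * z
  square-expanded = solve 3 (λ x y z →
    (z :* z) :* ((x :* y) :+ con 1) :+ con 1 := ((z :* z) :* (x :* y) :+ con 1) :+ z :* z) refl

  Eq1⇔ : ∀ x y z → Eq1 L x y z ⇔ (z * (x + y)) ≈ (z * z)
  Eq1⇔ x y z = mk⇔
    (λ eq1 → +-cancelˡ _ _ _ (trans (sym (Eq1-expanded x y z)) (trans eq1 (square-expanded x y z))))
    (λ eq → trans (Eq1-expanded x y z) (trans (+-congˡ eq) (sym (square-expanded x y z))))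

  Eq2⇔ : ∀ x y z → Eq2 L x y z ⇔ ((z + 1#) * ((x + y) + 1#)) ≈ ((z + 1#) * (z + 1#))
  Eq2⇔ x y z = mk⇔
    (λ eq2 → trans (*-congˡ (+-assoc x y 1#)) (Equivalence.to (Eq1⇔ x (y + 1#) (z + 1#)) eq2))
    (λ eq → Equivalence.from (Eq1⇔ x (y + 1#) (z + 1#)) (trans (*-congˡ (sym (+-assoc x y 1#))) eq))

  sum⇔Eq1×Eq2 : ∀ x y z → ((x + y) ≈ z) ⇔ (Eq1 L x y z × Eq2 L x y z)
  sum⇔Eq1×Eq2 x y z = mk⇔
    (λ x+y≈z → Equivalence.from (Eq1⇔ x y z) (*-congˡ x+y≈z)
             , Equivalence.from (Eq2⇔ x y z) (*-congˡ (+-congʳ x+y≈z)))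
    (λ (eq1 , eq2) → *-cancel-consecutive z (x + y) z
      (Equivalence.to (Eq1⇔ x y z) eq1)
      (*-suc-cancel (z + 1#) (x + y) z (Equivalence.to (Eq2⇔ x y z) eq2)))

record IsCongruence {a ℓ} (L : Arith a ℓ) : Set (a ⊔ ℓ) where
  open Arith L
  field
    isEquivalence : IsEquivalence _≈_
    +-cong        : Congruent₂ _≈_ _+_
    *-cong        : Congruent₂ _≈_ _*_

eq1Atoms : (x y z a b c d e f g h k : Fin 23) → List (AtomEq 23)
eq1Atoms x y z a b c d e f g h k =
  times z x a ∷ plus1 a b ∷ times z y c ∷ plus1 c d ∷ times b d e ∷
  times z z f ∷ times x y g ∷ plus1 g h ∷ times f h k ∷ plus1 k e ∷ []

system : List (AtomEq 23)
system = eq1Atoms (# 0) (# 1) (# 2) (# 3) (# 4) (# 5) (# 6) (# 7) (# 8) (# 9) (# 10) (# 11)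
  List.++ plus1 (# 1) (# 12) ∷ plus1 (# 2) (# 13)
  ∷ eq1Atoms (# 0) (# 12) (# 13) (# 14) (# 15) (# 16) (# 17) (# 18) (# 19) (# 20) (# 21) (# 22)

module Flattening {a ℓ} (L : Arith a ℓ) (isCongruence : IsCongruence L) where

  open Arith L
  open IsCongruence isCongruence
  open IsEquivalence isEquivalence

  setoid : Setoid a ℓ
  setoid = record { isEquivalence = isEquivalence }

  open SetoidReasoning setoid

  eq1Witnesses : Carrier → Carrier → Carrier → Vec Carrier 9
  eq1Witnesses x y z =
    (z * x) ∷ ((z * x) + 1#) ∷ (z * y) ∷ ((z * y) + 1#) ∷ (((z * x) + 1#) * ((z * y) + 1#)) ∷
    (z * z) ∷ (x * y) ∷ ((x * y) + 1#) ∷ ((z * z) * ((x * y) + 1#)) ∷ []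

  Eq1-resp : ∀ {x y z x′ y′ z′} → x ≈ x′ → y ≈ y′ → z ≈ z′ → Eq1 L x y z → Eq1 L x′ y′ z′
  Eq1-resp {x} {y} {z} {x′} {y′} {z′} x≈ y≈ z≈ eq1 = begin
    ((z′ * x′) + 1#) * ((z′ * y′) + 1#)     ≈⟨ *-cong (+-cong (*-cong z≈ x≈) refl) (+-cong (*-cong z≈ y≈) refl) ⟨
    ((z * x) + 1#) * ((z * y) + 1#)         ≈⟨ eq1 ⟩
    ((z * z) * ((x * y) + 1#)) + 1#         ≈⟨ +-cong (*-cong (*-cong z≈ z≈) (+-cong (*-cong x≈ y≈) refl)) refl ⟩
    ((z′ * z′) * ((x′ * y′) + 1#)) + 1#     ∎

  eq1Atoms-sound : ∀ (v : Fin 23 → Carrier) {x y z a b c d e f g h k} →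
    All (HoldsAtom L v) (eq1Atoms x y z a b c d e f g h k) → Eq1 L (v x) (v y) (v z)
  eq1Atoms-sound v {x} {y} {z} {a} {b} {c} {d} {e} {f} {g} {h} {k}
    (zx≈a ∷ a+1≈b ∷ zy≈c ∷ c+1≈d ∷ bd≈e ∷ zz≈f ∷ xy≈g ∷ g+1≈h ∷ fh≈k ∷ k+1≈e ∷ []) = begin
    ((v z * v x) + 1#) * ((v z * v y) + 1#) ≈⟨ *-cong (+-cong zx≈a refl) (+-cong zy≈c refl) ⟩
    (v a + 1#) * (v c + 1#)                 ≈⟨ *-cong a+1≈b c+1≈d ⟩
    v b * v d                               ≈⟨ bd≈e ⟩
    v e                                     ≈⟨ k+1≈e ⟨
    v k + 1#                                ≈⟨ +-cong fh≈k refl ⟨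
    (v f * v h) + 1#                        ≈⟨ +-cong (*-cong zz≈f (trans (+-cong xy≈g refl) g+1≈h)) refl ⟨
    ((v z * v z) * ((v x * v y) + 1#)) + 1# ∎

  Eq1×Eq2⇔system : ∀ x y z → (Eq1 L x y z × Eq2 L x y z)
    ⇔ Σ (Fin 20 → Carrier) (λ w → All (HoldsAtom L (valuation L x y z w)) system)
  Eq1×Eq2⇔system x y z = mk⇔ complete sound
    where
    witnesses : Vec Carrier 20
    witnesses = eq1Witnesses x y z ++ (y + 1#) ∷ (z + 1#) ∷ eq1Witnesses x (y + 1#) (z + 1#)

    complete : Eq1 L x y z × Eq2 L x y z → Σ (Fin 20 → Carrier) (λ w → All (HoldsAtom L (valuation L x y z w)) system)
    complete (eq1 , eq2) = lookup witnesses ,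
      ++⁺ (refl ∷ refl ∷ refl ∷ refl ∷ refl ∷ refl ∷ refl ∷ refl ∷ refl ∷ sym eq1 ∷ [])
          (refl ∷ refl ∷ refl ∷ refl ∷ refl ∷ refl ∷ refl ∷ refl ∷ refl ∷ refl ∷ refl ∷ sym eq2 ∷ [])

    sound : Σ (Fin 20 → Carrier) (λ w → All (HoldsAtom L (valuation L x y z w)) system) → Eq1 L x y z × Eq2 L x y z
    sound (w , holds) with ++⁻ (eq1Atoms _ _ _ _ _ _ _ _ _ _ _ _) holds
    ... | first , (y+1≈y′ ∷ z+1≈z′ ∷ second) =
      eq1Atoms-sound v first , Eq1-resp refl (sym y+1≈y′) (sym z+1≈z′) (eq1Atoms-sound v second)
      where v = valuation L x y z w

lemma3For : ∀ {a ℓ} (L : Arith a ℓ) → IsCongruence L →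
  (∀ x y z → (Arith._≈_ L (Arith._+_ L x y) z) ⇔ (Eq1 L x y z × Eq2 L x y z)) → Lemma3For L
lemma3For L isCongruence sum⇔Eq1×Eq2 = sum⇔Eq1×Eq2 , system , Flattening.Eq1×Eq2⇔system L isCongruence

semiringIsCongruence : ∀ {c ℓ} (S : CommutativeSemiring c ℓ) → IsCongruence (semiringArith S)
semiringIsCongruence S = record { isEquivalence = isEquivalence ; +-cong = +-cong ; *-cong = *-cong }
  where open CommutativeSemiring S

ringLemma3 : ∀ {c ℓ} (R : CommutativeRing c ℓ) → Lemma3For (ringArith R)
ringLemma3 R = lemma3For (ringArith R) (semiringIsCongruence commutativeSemiring)
  (AdditivelyCancellative.sum⇔Eq1×Eq2 commutativeSemiring (GroupProperties.∙-cancelˡ +-group))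
  where open CommutativeRing R

ℕLemma3 : Lemma3For ℕArith
ℕLemma3 = lemma3For ℕArith (semiringIsCongruence +-*-commutativeSemiring)
  (AdditivelyCancellative.sum⇔Eq1×Eq2 +-*-commutativeSemiring +-cancelˡ-≡)

ℕ⁺IsCongruence : IsCongruence ℕ⁺Arith
ℕ⁺IsCongruence = record
  { isEquivalence = On.isEquivalence proj₁ ≡.isEquivalence
  ; +-cong = ≡.cong₂ ℕ._+_
  ; *-cong = ≡.cong₂ ℕ._*_
  }

-- ℕ⁺ has no zero, so is no semiring; but its equations are definitionally equations
-- between the underlying naturals, to which the ℕ argument applies.
ℕ⁺Lemma3 : Lemma3For ℕ⁺Arith
ℕ⁺Lemma3 = lemma3For ℕ⁺Arith ℕ⁺IsCongruence
  (λ x y z → AdditivelyCancellative.sum⇔Eq1×Eq2 +-*-commutativeSemiring +-cancelˡ-≡ (proj₁ x) (proj₁ y) (proj₁ z))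

lemma3 : Lemma3Statement
lemma3 = record { forRings = ringLemma3 ; forℕ = ℕLemma3 ; forℕ⁺ = ℕ⁺Lemma3 }
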